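{- Let $m\geq t\geq 3$ be integers and suppose $mt\equiv 0$ or $3\pmod 4$. Then there exists a signed magic array $SMA(m,2m;2t,t)$.
   Context: For positive integers $m,n,s,t$, a signed magic array $SMA(m,n;s,t)$ is an $m\times n$ array ($m$ rows, $n$ columns), some of whose cells may be empty, with entries from the set $X$, where $X=\{0,\pm1,\pm2,\ldots,\pm (ms-1)/2\}$ if $ms$ is odd and $X=\{\pm1,\pm2,\ldots,\pm ms/2\}$ if $ms$ is even, such that precisely $s$ cells in every row and precisely $t$ cells in every column are filled, every integer in $X$ appears exactly once in the array, and the sum of each row and of each column is zero. -}

module Defs where

import Algebra.Properties.CommutativeMonoid.Sum as Sum
open import Data.Fin.Base using (Fin)
open import Data.Integer.Base using (ℤ; 0ℤ; ∣_∣)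
import Data.Integer.Properties as ℤ
open import Data.Maybe.Base using (Maybe; just; fromMaybe; is-just)
open import Data.Bool.Base using (if_then_else_)
open import Data.Nat.Base using (ℕ; _*_; _∸_; _/_; _%_; _≤_)
import Data.Nat.Properties as ℕ
open import Data.Product using (_×_; _,_; ∃!)
open import Data.Vec.Functional using (Vector)
open import Relation.Binary.PropositionalEquality using (_≡_)

open Sum ℤ.+-0-commutativeMonoid public using () renaming (sum to sumℤ)
open Sum ℕ.+-0-commutativeMonoid public using () renaming (sum to sumℕ)

-- `nothing` is an empty cell.
PartialArray : ℕ → ℕ → Set
PartialArray m n = Fin m → Fin n → Maybe ℤ

filled : ∀ {n} → Vector (Maybe ℤ) n → ℕ
filled v = sumℕ (λ i → if is-just (v i) then 1 else 0)

total : ∀ {n} → Vector (Maybe ℤ) n → ℤ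
total v = sumℤ (λ i → fromMaybe 0ℤ (v i))

-- z ∈X k says that z belongs to {0, ±1, …, ±(k-1)/2} when k is odd and to
-- {±1, …, ±k/2} when k is even.
data _∈X_ (z : ℤ) (k : ℕ) : Set where
  odd  : k % 2 ≡ 1 → ∣ z ∣ ≤ (k ∸ 1) / 2 → z ∈X k
  even : k % 2 ≡ 0 → 1 ≤ ∣ z ∣ → ∣ z ∣ ≤ k / 2 → z ∈X k

record IsSMA (m n s t : ℕ) (A : PartialArray m n) : Set where
  field
    entries    : ∀ i j z → A i j ≡ just z → z ∈X (m * s)
    row-filled : ∀ i → filled (λ j → A i j) ≡ s
    col-filled : ∀ j → filled (λ i → A i j) ≡ t
    once       : ∀ z → z ∈X (m * s) →
                 ∃! _≡_ λ ((i , j) : Fin m × Fin n) → A i j ≡ just z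
    row-sum    : ∀ i → total (λ j → A i j) ≡ 0ℤ
    col-sum    : ∀ j → total (λ i → A i j) ≡ 0ℤ

{-# OPTIONS --safe #-}
-- The array is a pair of m × m halves A, B placed side by side, whose cells
-- (i, j) are filled exactly when i + j ≡ d (mod m) for a layer d < t.  Suppose
-- layer d of column j holds a(d,j) in A and b(d,j) in B.  The columns vanish if
-- Σ_d a(d,j) = Σ_d b(d,j) = 0, and the rows vanish if a(d,j) + b(d,j) = w(d) does
-- not depend on j: a row meets every layer once in each half, so it sums to
-- Σ_d w(d) = 0.  For t = 0 there is nothing to do, for t = 3 take, for 0 ≤ j < m,
--   a : -(3m-j),   1+j,    3m-1-2j        b : -(m+1+j),  -(1+j),  m+2+2j
-- and go from t to t + 2 by adding two layers
--   a : ±(mt+1+j)                         b : ∓(mt+m+1+j).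
module Submission where

open import Algebra.Bundles using (CommutativeMonoid)
import Algebra.Properties.CommutativeMonoid.Sum as CommutativeMonoidSum
open import Data.Bool.Base using (if_then_else_)
open import Data.Fin.Base
  using (Fin; suc; toℕ; fromℕ<; cast; combine; remQuot; splitAt; opposite; _↑ˡ_; _↑ʳ_)
open import Data.Fin.Patterns using (0F; 1F; 2F)
open import Data.Fin.Permutation using (Permutation′)
open import Data.Fin.Properties
  using (toℕ<n; toℕ-injective; toℕ-fromℕ<; toℕ-cast; toℕ-combine; toℕ-↑ˡ; toℕ-↑ʳ;
         cast-involutive; combine-remQuot; remQuot-combine; opposite-prop;
         opposite-involutive; splitAt-↑ˡ; splitAt-↑ʳ; splitAt⁻¹-↑ˡ; splitAt⁻¹-↑ʳ)
open import Data.Integer.Base using (ℤ; +[1+_]; -[1+_]; 0ℤ; ∣_∣; sign; _◃_) renaming (_+_ to _+ℤ_)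
import Data.Integer.Properties as ℤ
open import Data.Maybe.Base using (Maybe; just; nothing; fromMaybe; is-just)
open import Data.Maybe.Properties using (just-injective)
open import Data.Nat.Base using (ℕ; suc; NonZero; _+_; _*_; _∸_; _%_; _/_; _≤_; _<_; _≥_; s≤s; z≤n)
open import Data.Nat.DivMod
  using (_mod_; m%n<n; m%n%n≡m%n; [m+n]%n≡m%n; m<n⇒m%n≡m; %-distribˡ-+; m*n%n≡0; m*n/n≡m)
import Data.Nat.Properties as ℕ
open import Data.Nat.Tactic.RingSolver using (solve-∀)
open import Data.Product using (∃; ∃!; _×_; _,_; proj₁; proj₂; map₂)
open import Data.Sign.Base as Sign using (Sign)
open import Data.Sum.Base using (_⊎_; inj₁; inj₂; [_,_]′)
open import Function.Base using (_∘_; const)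
open import Function.Bundles using (_↔_; mk↔ₛ′; module Inverse)
open import Relation.Nullary.Negation using (contradiction)
open import Relation.Binary.PropositionalEquality
  using (_≡_; _≢_; refl; sym; trans; cong; cong₂; subst; module ≡-Reasoning)
open import Defs

-- Splitting sums over finite index sets

module _ {c ℓ} (M : CommutativeMonoid c ℓ) where
  open CommutativeMonoid M using (Carrier; _≈_; _∙_; ε; ∙-congˡ; ∙-cong; identityˡ; identityʳ; reflexive)
    renaming (sym to ≈-sym; assoc to ∙-assoc; trans to ≈-trans)
  open CommutativeMonoidSum M using (sum; sum-cong-≋; sum-replicate-zero)

  sum-+ : ∀ m {n} (f : Fin (m + n) → Carrier) →
          sum f ≈ sum (λ i → f (i ↑ˡ n)) ∙ sum (λ i → f (m ↑ʳ i))
  sum-+ 0       f = ≈-sym (identityˡ _)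
  sum-+ (suc m) f = ≈-trans (∙-congˡ (sum-+ m (f ∘ suc))) (≈-sym (∙-assoc _ _ _))

  -- The second block contributes only units. It will consist of the empty cells, so one statement
  -- serves both for counting filled cells and for adding entries.
  sum-supported : ∀ t {k} (f : Fin t ⊎ Fin k → Carrier) → (∀ i → f (inj₂ i) ≈ ε) →
                  sum (f ∘ splitAt t) ≈ sum (f ∘ inj₁)
  sum-supported t {k} f f≈ε = ≈-trans (sum-+ t _)
    (≈-trans (∙-cong
      (sum-cong-≋ (λ i → reflexive (cong f (splitAt-↑ˡ t i k))))
      (≈-trans
        (sum-cong-≋ (λ i → ≈-trans (reflexive (cong f (splitAt-↑ʳ t k i))) (f≈ε i)))
        (sum-replicate-zero k)))
    (identityʳ _))

  sum-halves : ∀ m (f : Fin 2 × Fin m → Carrier) →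
               sum (f ∘ remQuot m) ≈ sum (λ j → f (0F , j)) ∙ sum (λ j → f (1F , j))
  sum-halves m f = ≈-trans (sum-+ m _) (∙-cong
    (sum-cong-≋ (at 0F))
    -- `2 * m` unfolds to `m + (m + 0)`, so the second half is split once more and leaves an empty
    -- sum.
    (≈-trans (sum-+ m _) (≈-trans (identityʳ _) (sum-cong-≋ (at 1F)))))
    where
    at : ∀ h j → f (remQuot m (combine h j)) ≈ f (h , j)
    at h j = reflexive (cong f (remQuot-combine h j))

sum-ones : ∀ n → sumℕ {n} (const 1) ≡ n
sum-ones 0       = refl
sum-ones (suc n) = cong suc (sum-ones n)

-- Layers of signed entries

record Layers (m t n : ℕ) : Set where
  field
    -- The triple is half, layer, column. A pair `(s , k)` codes the integer of sign `s` and
    -- absolute value k + 1, so the bijection says that each of ±1, ..., ±n is used exactly once.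
    position : (Fin 2 × Fin t × Fin m) ↔ (Sign × Fin n)

  entry : Fin 2 → Fin t → Fin m → ℤ
  entry h d j = let s , k = Inverse.to position (h , d , j) in s ◃ suc (toℕ k)

  field
    column-zero  : ∀ h j → sumℤ (λ d → entry h d j) ≡ 0ℤ
    pairSum      : Fin t → ℤ
    pair         : ∀ d j → entry 0F d j +ℤ entry 1F d j ≡ pairSum d
    pairSum-zero : sumℤ pairSum ≡ 0ℤ

-- Cancellation of signed integers

suc-toℕ+opposite : ∀ {m} (i : Fin m) → suc (toℕ i) + toℕ (opposite i) ≡ m
suc-toℕ+opposite {m} i = trans (cong (suc (toℕ i) +_) (opposite-prop i)) (ℕ.m+[n∸m]≡n (toℕ<n i))

-- The shape is that of `sumℤ` over `Fin 3`, which ends in `0ℤ`. Absolute values exceed `a`, `b`,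
-- `c` by one, which accounts for the `suc` in the hypothesis.
neg+neg+pos : ∀ {a b c} → suc (a + b) ≡ c → -[1+ a ] +ℤ (-[1+ b ] +ℤ (+[1+ c ] +ℤ 0ℤ)) ≡ 0ℤ
neg+neg+pos {a} {b} refl = begin
  -[1+ a ] +ℤ (-[1+ b ] +ℤ (+[1+ c ] +ℤ 0ℤ)) ≡⟨ cong (λ x → -[1+ a ] +ℤ (-[1+ b ] +ℤ x)) (ℤ.+-identityʳ +[1+ c ]) ⟩
  -[1+ a ] +ℤ (-[1+ b ] +ℤ +[1+ c ])         ≡⟨ sym (ℤ.+-assoc -[1+ a ] -[1+ b ] +[1+ c ]) ⟩
  -[1+ c ] +ℤ +[1+ c ]                       ≡⟨ ℤ.+-inverseˡ +[1+ c ] ⟩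
  0ℤ                                         ∎
  where
  open ≡-Reasoning
  c = suc (a + b)

neg+pos+pos : ∀ {a b c} → a ≡ suc (b + c) → -[1+ a ] +ℤ (+[1+ b ] +ℤ (+[1+ c ] +ℤ 0ℤ)) ≡ 0ℤ
neg+pos+pos {b = b} {c} refl = begin
  -[1+ a ] +ℤ (+[1+ b ] +ℤ (+[1+ c ] +ℤ 0ℤ)) ≡⟨ cong (λ x → -[1+ a ] +ℤ (+[1+ b ] +ℤ x)) (ℤ.+-identityʳ +[1+ c ]) ⟩
  -[1+ a ] +ℤ (+[1+ b ] +ℤ +[1+ c ])         ≡⟨ cong (λ x → -[1+ a ] +ℤ +[1+ x ]) (ℕ.+-suc b c) ⟩
  -[1+ a ] +ℤ +[1+ a ]                       ≡⟨ ℤ.+-inverseˡ +[1+ a ] ⟩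
  0ℤ                                         ∎
  where
  open ≡-Reasoning
  a = suc (b + c)

◃-inverseʳ : ∀ s n → (s ◃ n) +ℤ (Sign.opposite s ◃ n) ≡ 0ℤ
◃-inverseʳ Sign.+ 0       = refl
◃-inverseʳ Sign.- 0       = refl
◃-inverseʳ Sign.+ (suc n) = ℤ.+-inverseʳ +[1+ n ]
◃-inverseʳ Sign.- (suc n) = ℤ.+-inverseʳ -[1+ n ]

◃-cancel : ∀ s n {z} → z ≡ 0ℤ → (s ◃ n) +ℤ ((Sign.opposite s ◃ n) +ℤ z) ≡ 0ℤ
◃-cancel s n refl = trans (cong ((s ◃ n) +ℤ_) (ℤ.+-identityʳ _)) (◃-inverseʳ s n)

-- The right side is free of `x`: this is why pair sums in an added layer do not depend on the
-- column.
◃-difference : ∀ s m x → (s ◃ suc x) +ℤ (Sign.opposite s ◃ suc (m + x)) ≡ Sign.opposite s ◃ m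
◃-difference s m x = begin
  (s ◃ suc x) +ℤ (s′ ◃ suc (m + x))            ≡⟨ cong (λ y → (s ◃ suc x) +ℤ (s′ ◃ suc y)) (ℕ.+-comm m x) ⟩
  (s ◃ suc x) +ℤ (s′ ◃ (suc x + m))            ≡⟨ cong ((s ◃ suc x) +ℤ_) (ℤ.◃-distrib-+ s′ (suc x) m) ⟩
  (s ◃ suc x) +ℤ ((s′ ◃ suc x) +ℤ (s′ ◃ m))    ≡⟨ sym (ℤ.+-assoc (s ◃ suc x) (s′ ◃ suc x) (s′ ◃ m)) ⟩
  ((s ◃ suc x) +ℤ (s′ ◃ suc x)) +ℤ (s′ ◃ m)    ≡⟨ cong (_+ℤ (s′ ◃ m)) (◃-inverseʳ s (suc x)) ⟩
  0ℤ +ℤ (s′ ◃ m)                               ≡⟨ ℤ.+-identityˡ _ ⟩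
  s′ ◃ m                                       ∎
  where
  open ≡-Reasoning
  s′ = Sign.opposite s

noLayers : ∀ m → Layers m 0 0
noLayers m = record
  { position     = mk↔ₛ′ (λ { (_ , () , _) }) (λ { (_ , ()) }) (λ { (_ , ()) }) (λ { (_ , () , _) })
  ; column-zero  = λ _ _ → refl
  ; pairSum      = λ ()
  ; pair         = λ ()
  ; pairSum-zero = refl
  }

-- The base case of three layers

module ThreeLayers (m : ℕ) where
  -- Absolute values up to m go to the middle layer with both signs. Above m, the negatives form two
  -- consecutive blocks of length m, while the positives interleave in m adjacent pairs; hence the
  -- two orders of `combine`. Descending sequences use `opposite j`.
  to : Fin 2 × Fin 3 × Fin m → Sign × Fin (m + 2 * m)
  to (0F , 0F , j) = Sign.- , m ↑ʳ combine {2} 1F (opposite j)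
  to (0F , 1F , j) = Sign.+ , j ↑ˡ (2 * m)
  to (0F , 2F , j) = Sign.+ , m ↑ʳ cast (ℕ.*-comm m 2) (combine {m} {2} (opposite j) 0F)
  to (1F , 0F , j) = Sign.- , m ↑ʳ combine {2} 0F j
  to (1F , 1F , j) = Sign.- , j ↑ˡ (2 * m)
  to (1F , 2F , j) = Sign.+ , m ↑ʳ cast (ℕ.*-comm m 2) (combine {m} {2} j 1F)

  fromNegative : Fin 2 × Fin m → Fin 2 × Fin 3 × Fin m
  fromNegative (0F , j) = 1F , 0F , j
  fromNegative (1F , j) = 0F , 0F , opposite j

  fromPositive : Fin m × Fin 2 → Fin 2 × Fin 3 × Fin m
  fromPositive (j , 0F) = 0F , 2F , opposite j
  fromPositive (j , 1F) = 1F , 2F , j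

  fromSplit : Sign → Fin m ⊎ Fin (2 * m) → Fin 2 × Fin 3 × Fin m
  fromSplit Sign.+ (inj₁ j) = 0F , 1F , j
  fromSplit Sign.- (inj₁ j) = 1F , 1F , j
  fromSplit Sign.+ (inj₂ r) = fromPositive (remQuot 2 (cast (ℕ.*-comm 2 m) r))
  fromSplit Sign.- (inj₂ r) = fromNegative (remQuot m r)

  from : Sign × Fin (m + 2 * m) → Fin 2 × Fin 3 × Fin m
  from (s , k) = fromSplit s (splitAt m k)

  to-fromNegative : ∀ p → to (fromNegative p) ≡ (Sign.- , m ↑ʳ combine (proj₁ p) (proj₂ p))
  to-fromNegative (0F , j) = refl
  to-fromNegative (1F , j) rewrite opposite-involutive j = refl

  to-fromPositive : ∀ p → to (fromPositive p) ≡
                    (Sign.+ , m ↑ʳ cast (ℕ.*-comm m 2) (combine (proj₁ p) (proj₂ p)))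
  to-fromPositive (j , 0F) rewrite opposite-involutive j = refl
  to-fromPositive (j , 1F) = refl

  -- Generalising `splitAt m k` to `x` lets `fromSplit` reduce by matching, while the equation
  -- recovers `k`.
  to-fromSplit : ∀ s k x → splitAt m k ≡ x → to (fromSplit s x) ≡ (s , k)
  to-fromSplit Sign.+ k (inj₁ j) eq = cong (Sign.+ ,_) (splitAt⁻¹-↑ˡ eq)
  to-fromSplit Sign.- k (inj₁ j) eq = cong (Sign.- ,_) (splitAt⁻¹-↑ˡ eq)
  to-fromSplit Sign.+ k (inj₂ r) eq = trans
    (to-fromPositive (remQuot 2 (cast (ℕ.*-comm 2 m) r)))
    (cong (Sign.+ ,_) (trans
      (cong (λ x → m ↑ʳ cast (ℕ.*-comm m 2) x) (combine-remQuot {m} 2 (cast (ℕ.*-comm 2 m) r)))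
      (trans (cong (m ↑ʳ_) (cast-involutive (ℕ.*-comm m 2) (ℕ.*-comm 2 m) r)) (splitAt⁻¹-↑ʳ eq))))
  to-fromSplit Sign.- k (inj₂ r) eq = trans
    (to-fromNegative (remQuot m r))
    (cong (Sign.- ,_) (trans (cong (m ↑ʳ_) (combine-remQuot {2} m r)) (splitAt⁻¹-↑ʳ eq)))

  from-negative : ∀ h j → from (Sign.- , m ↑ʳ combine h j) ≡ fromNegative (h , j)
  from-negative h j = trans (cong (fromSplit Sign.-) (splitAt-↑ʳ m (2 * m) (combine h j)))
                            (cong fromNegative (remQuot-combine h j))

  from-positive : ∀ j h → from (Sign.+ , m ↑ʳ cast (ℕ.*-comm m 2) (combine {m} {2} j h)) ≡ fromPositive (j , h)
  from-positive j h = trans (cong (fromSplit Sign.+) (splitAt-↑ʳ m (2 * m) _))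
    (cong fromPositive (trans
      (cong (remQuot 2) (cast-involutive (ℕ.*-comm 2 m) (ℕ.*-comm m 2) (combine j h)))
      (remQuot-combine j h)))

  from-to : ∀ p → from (to p) ≡ p
  from-to (0F , 0F , j) = trans (from-negative 1F (opposite j))
                                (cong (λ x → 0F , 0F , x) (opposite-involutive j))
  from-to (0F , 1F , j) = cong (fromSplit Sign.+) (splitAt-↑ˡ m j (2 * m))
  from-to (0F , 2F , j) = trans (from-positive (opposite j) 0F)
                                (cong (λ x → 0F , 2F , x) (opposite-involutive j))
  from-to (1F , 0F , j) = from-negative 0F j
  from-to (1F , 1F , j) = cong (fromSplit Sign.-) (splitAt-↑ˡ m j (2 * m))
  from-to (1F , 2F , j) = from-positive j 1F

  magnitude : Fin 2 → Fin 3 → Fin m → ℕ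
  magnitude h d j = toℕ (proj₂ (to (h , d , j)))

  toℕ-↑ʳ-combine : ∀ h (j : Fin m) → toℕ (m ↑ʳ combine {2} h j) ≡ m + (m * toℕ h + toℕ j)
  toℕ-↑ʳ-combine h j = trans (toℕ-↑ʳ m _) (cong (m +_) (toℕ-combine h j))

  toℕ-↑ʳ-cast : ∀ j (h : Fin 2) →
                toℕ (m ↑ʳ cast (ℕ.*-comm m 2) (combine {m} {2} j h)) ≡ m + (2 * toℕ j + toℕ h)
  toℕ-↑ʳ-cast j h = trans (toℕ-↑ʳ m _) (cong (m +_) (trans (toℕ-cast (ℕ.*-comm m 2) (combine {m} {2} j h)) (toℕ-combine j h)))

  module _ (j : Fin m) where
    i o : ℕ
    i = toℕ j
    o = toℕ (opposite j)

    -- Trading m for i + o + 1 removes the subtraction hidden in `opposite j` and leaves polynomial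
    -- identities in i and o.
    reverse : (P : ℕ → ℕ → ℕ → Set) → (∀ i o → P (suc (i + o)) i o) → P m i o
    reverse P p = subst (λ x → P x i o) (suc-toℕ+opposite j) (p i o)

    m₀₀ : magnitude 0F 0F j ≡ m + (m * 1 + o)
    m₀₀ = toℕ-↑ʳ-combine 1F (opposite j)

    m₀₁ : magnitude 0F 1F j ≡ i
    m₀₁ = toℕ-↑ˡ j (2 * m)

    m₀₂ : magnitude 0F 2F j ≡ m + (2 * o + 0)
    m₀₂ = toℕ-↑ʳ-cast (opposite j) 0F

    m₁₀ : magnitude 1F 0F j ≡ m + (m * 0 + i)
    m₁₀ = toℕ-↑ʳ-combine 0F j

    m₁₁ : magnitude 1F 1F j ≡ i
    m₁₁ = toℕ-↑ˡ j (2 * m)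

    m₁₂ : magnitude 1F 2F j ≡ m + (2 * i + 1)
    m₁₂ = toℕ-↑ʳ-cast j 1F

    -- In absolute values, 3m - j = (1 + j) + (3m - 1 - 2j).
    column₀ : magnitude 0F 0F j ≡ suc (magnitude 0F 1F j + magnitude 0F 2F j)
    column₀ = trans m₀₀ (trans
      (reverse (λ m i o → m + (m * 1 + o) ≡ suc (i + (m + (2 * o + 0)))) solve-∀)
      (sym (cong suc (cong₂ _+_ m₀₁ m₀₂))))

    column₁ : suc (magnitude 1F 0F j + magnitude 1F 1F j) ≡ magnitude 1F 2F j
    column₁ = trans (cong suc (cong₂ _+_ m₁₀ m₁₁)) (trans (double m i) (sym m₁₂))
      where
      double : ∀ m i → suc (m + (m * 0 + i) + i) ≡ m + (2 * i + 1)
      double = solve-∀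

    -- The column cancels: (3m - j) + (m + 1 + j) = 4m + 1. In `pair₂` likewise (3m - 1 - 2j) + (m +
    -- 2 + 2j) = 4m + 1, with the opposite sign. Each `suc` sits where integer addition reduces to
    -- it.
    pair₀ : suc (magnitude 0F 0F j + magnitude 1F 0F j) ≡ 4 * m
    pair₀ = trans (cong suc (cong₂ _+_ m₀₀ m₁₀))
      (reverse (λ m i o → suc (m + (m * 1 + o) + (m + (m * 0 + i))) ≡ 4 * m) solve-∀)

    pair₂ : magnitude 0F 2F j + suc (magnitude 1F 2F j) ≡ 4 * m
    pair₂ = trans (cong₂ (λ x y → x + suc y) m₀₂ m₁₂)
      (reverse (λ m i o → m + (2 * o + 0) + suc (m + (2 * i + 1)) ≡ 4 * m) solve-∀)

  layers : Layers m 3 (m + 2 * m)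
  layers = record
    { position     = mk↔ₛ′ to from (λ (s , k) → to-fromSplit s k _ refl) from-to
    ; column-zero  = λ { 0F j → neg+pos+pos {b = magnitude 0F 1F j} (column₀ j)
                       ; 1F j → neg+neg+pos {magnitude 1F 0F j} (column₁ j) }
    ; pairSum      = λ { 0F → -[1+ 4 * m ] ; 1F → 0ℤ ; 2F → +[1+ 4 * m ] }
    ; pair         = λ { 0F j → cong -[1+_] (pair₀ j)
                       ; 1F j → ℤ.+-inverseʳ +[1+ magnitude 0F 1F j ]
                       ; 2F j → cong +[1+_] (pair₂ j) }
    ; pairSum-zero = trans (cong (-[1+ 4 * m ] +ℤ_) (trans (ℤ.+-identityˡ _) (ℤ.+-identityʳ +[1+ 4 * m ])))
                           (ℤ.+-inverseˡ +[1+ 4 * m ])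
    }

-- Adding two layers

module TwoMoreLayers {m t n : ℕ} (L : Layers m t n) where
  private module L = Layers L

  -- The sign flips with the layer, so that columns cancel, and with the half, so that pair sums are
  -- differences.
  signAt : Fin 2 → Fin 2 → Sign
  signAt 0F 0F = Sign.+
  signAt 0F 1F = Sign.-
  signAt 1F 0F = Sign.-
  signAt 1F 1F = Sign.+

  to : Fin 2 × Fin (2 + t) × Fin m → Sign × Fin (n + 2 * m)
  to (h , 0F , j)          = signAt h 0F , n ↑ʳ combine h j
  to (h , 1F , j)          = signAt h 1F , n ↑ʳ combine h j
  to (h , suc (suc d) , j) = map₂ (_↑ˡ (2 * m)) (Inverse.to L.position (h , d , j))

  fromNew : Sign → Fin 2 × Fin m → Fin 2 × Fin (2 + t) × Fin m
  fromNew Sign.+ (0F , j) = 0F , 0F , j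
  fromNew Sign.- (0F , j) = 0F , 1F , j
  fromNew Sign.- (1F , j) = 1F , 0F , j
  fromNew Sign.+ (1F , j) = 1F , 1F , j

  old : Fin 2 × Fin t × Fin m → Fin 2 × Fin (2 + t) × Fin m
  old (h , d , j) = h , suc (suc d) , j

  fromSplit : Sign → Fin n ⊎ Fin (2 * m) → Fin 2 × Fin (2 + t) × Fin m
  fromSplit s (inj₁ k) = old (Inverse.from L.position (s , k))
  fromSplit s (inj₂ r) = fromNew s (remQuot m r)

  from : Sign × Fin (n + 2 * m) → Fin 2 × Fin (2 + t) × Fin m
  from (s , k) = fromSplit s (splitAt n k)

  to-fromNew : ∀ s p → to (fromNew s p) ≡ (s , n ↑ʳ combine (proj₁ p) (proj₂ p))
  to-fromNew Sign.+ (0F , j) = refl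
  to-fromNew Sign.- (0F , j) = refl
  to-fromNew Sign.- (1F , j) = refl
  to-fromNew Sign.+ (1F , j) = refl

  to-fromSplit : ∀ s k x → splitAt n k ≡ x → to (fromSplit s x) ≡ (s , k)
  to-fromSplit s k (inj₁ k′) eq = trans
    (cong (map₂ (_↑ˡ (2 * m))) (Inverse.strictlyInverseˡ L.position (s , k′)))
    (cong (s ,_) (splitAt⁻¹-↑ˡ eq))
  to-fromSplit s k (inj₂ r)  eq = trans (to-fromNew s (remQuot m r))
    (cong (s ,_) (trans (cong (n ↑ʳ_) (combine-remQuot {2} m r)) (splitAt⁻¹-↑ʳ eq)))

  from-new : ∀ s h j → from (s , n ↑ʳ combine h j) ≡ fromNew s (h , j)
  from-new s h j = trans (cong (fromSplit s) (splitAt-↑ʳ n (2 * m) (combine h j)))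
                         (cong (fromNew s) (remQuot-combine h j))

  from-to : ∀ p → from (to p) ≡ p
  from-to (0F , 0F , j) = from-new Sign.+ 0F j
  from-to (0F , 1F , j) = from-new Sign.- 0F j
  from-to (1F , 0F , j) = from-new Sign.- 1F j
  from-to (1F , 1F , j) = from-new Sign.+ 1F j
  from-to (h , suc (suc d) , j) = let s , k = Inverse.to L.position (h , d , j) in trans
    (cong (fromSplit s) (splitAt-↑ˡ n k (2 * m)))
    (cong old (Inverse.strictlyInverseʳ L.position (h , d , j)))

  position : (Fin 2 × Fin (2 + t) × Fin m) ↔ (Sign × Fin (n + 2 * m))
  position = mk↔ₛ′ to from (λ (s , k) → to-fromSplit s k _ refl) from-to

  entry : Fin 2 → Fin (2 + t) → Fin m → ℤ
  entry h d j = let s , k = to (h , d , j) in s ◃ suc (toℕ k)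

  entry-old : ∀ h d j → entry h (suc (suc d)) j ≡ L.entry h d j
  entry-old h d j = let s , k = Inverse.to L.position (h , d , j) in
    cong (λ x → s ◃ suc x) (toℕ-↑ˡ k (2 * m))

  open CommutativeMonoidSum ℤ.+-0-commutativeMonoid using (sum-cong-≗)

  column-zero : ∀ h j → sumℤ (λ d → entry h d j) ≡ 0ℤ
  column-zero h j = new h (trans (sum-cong-≗ (λ d → entry-old h d j)) (L.column-zero h j))
    where
    -- Matching on `h` makes `signAt` reduce to two opposite signs on the same absolute value.
    new : ∀ h {y} → y ≡ 0ℤ → entry h 0F j +ℤ (entry h 1F j +ℤ y) ≡ 0ℤ
    new 0F = ◃-cancel Sign.+ (suc (toℕ (n ↑ʳ combine {2} 0F j)))
    new 1F = ◃-cancel Sign.- (suc (toℕ (n ↑ʳ combine {2} 1F j)))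

  -- The block of new absolute values used in half 1 directly follows the one used in half 0, so the
  -- gap is the block length.
  difference : ∀ (j : Fin m) → toℕ (n ↑ʳ combine {2} 1F j) ≡ m + toℕ (n ↑ʳ combine {2} 0F j)
  difference j = begin
    toℕ (n ↑ʳ combine {2} 1F j)     ≡⟨ trans (toℕ-↑ʳ n _) (cong (n +_) (toℕ-combine {2} 1F j)) ⟩
    n + (m * 1 + toℕ j)             ≡⟨ shift m n (toℕ j) ⟩
    m + (n + (m * 0 + toℕ j))       ≡⟨ cong (m +_) (sym (trans (toℕ-↑ʳ n _) (cong (n +_) (toℕ-combine {2} 0F j)))) ⟩
    m + toℕ (n ↑ʳ combine {2} 0F j) ∎
    where
    open ≡-Reasoning
    shift : ∀ m n j → n + (m * 1 + j) ≡ m + (n + (m * 0 + j))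
    shift = solve-∀

  pairSum : Fin (2 + t) → ℤ
  pairSum 0F            = Sign.- ◃ m
  pairSum 1F            = Sign.+ ◃ m
  pairSum (suc (suc d)) = L.pairSum d

  pair : ∀ d j → entry 0F d j +ℤ entry 1F d j ≡ pairSum d
  pair 0F j rewrite difference j = ◃-difference Sign.+ m (toℕ (n ↑ʳ combine {2} 0F j))
  pair 1F j rewrite difference j = ◃-difference Sign.- m (toℕ (n ↑ʳ combine {2} 0F j))
  pair (suc (suc d)) j = trans (cong₂ _+ℤ_ (entry-old 0F d j) (entry-old 1F d j)) (L.pair d j)

  pairSum-zero : sumℤ pairSum ≡ 0ℤ
  pairSum-zero = ◃-cancel Sign.- m L.pairSum-zero

  layers : Layers m (2 + t) (n + 2 * m)
  layers = record
    { position     = position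
    ; column-zero  = column-zero
    ; pairSum      = pairSum
    ; pair         = pair
    ; pairSum-zero = pairSum-zero
    }

-- Layers of every size

layersOfSize : ∀ m t → t ≢ 1 → Layers m t (m * t)
layersOfSize m 0 _   = subst (Layers m 0) (sym (ℕ.*-zeroʳ m)) (noLayers m)
layersOfSize m 1 1≢1 = contradiction refl 1≢1
layersOfSize m 2 _   = subst (Layers m 2) (size m) (TwoMoreLayers.layers (noLayers m))
  where
  size : ∀ m → 0 + 2 * m ≡ m * 2
  size = solve-∀
layersOfSize m 3 _   = subst (Layers m 3) (size m) (ThreeLayers.layers m)
  where
  size : ∀ m → m + 2 * m ≡ m * 3
  size = solve-∀
-- Steps of two descend to 2 or 3. The recursive argument stays at least 2, so `λ ()` refutes that
-- it is 1.
layersOfSize m (suc (suc t@(suc (suc _)))) _ =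
  subst (Layers m (2 + t)) (size m t) (TwoMoreLayers.layers (layersOfSize m t λ ()))
  where
  size : ∀ m t → m * t + 2 * m ≡ m * (2 + t)
  size = solve-∀

-- The cyclic Latin square

module Latin (m : ℕ) .{{_ : NonZero m}} where
  infixl 6 _⊕_ _⊖_

  _⊕_ _⊖_ : Fin m → Fin m → Fin m
  i ⊕ j = (toℕ i + toℕ j) mod m
  d ⊖ j = (toℕ d + (m ∸ toℕ j)) mod m

  toℕ-mod : ∀ x → toℕ (x mod m) ≡ x % m
  toℕ-mod x = toℕ-fromℕ< (m%n<n x m)

  -- Adding `y` and then `y′` adds m in total, which vanishes modulo m. Both inverse laws follow,
  -- with j and m - j in either order.
  mod-cancel : ∀ (i : Fin m) y y′ → y + y′ ≡ m → (toℕ ((toℕ i + y) mod m) + y′) mod m ≡ i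
  mod-cancel i y y′ y+y′≡m = toℕ-injective (begin
    toℕ ((toℕ ((x + y) mod m) + y′) mod m) ≡⟨ toℕ-mod _ ⟩
    (toℕ ((x + y) mod m) + y′) % m         ≡⟨ cong (λ z → (z + y′) % m) (toℕ-mod (x + y)) ⟩
    ((x + y) % m + y′) % m                 ≡⟨ %-distribˡ-+ ((x + y) % m) y′ m ⟩
    ((x + y) % m % m + y′ % m) % m         ≡⟨ cong (λ z → (z + y′ % m) % m) (m%n%n≡m%n (x + y) m) ⟩
    ((x + y) % m + y′ % m) % m             ≡⟨ sym (%-distribˡ-+ (x + y) y′ m) ⟩
    (x + y + y′) % m                       ≡⟨ cong (_% m) (ℕ.+-assoc x y y′) ⟩
    (x + (y + y′)) % m                     ≡⟨ cong (λ z → (x + z) % m) y+y′≡m ⟩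
    (x + m) % m                            ≡⟨ [m+n]%n≡m%n x m ⟩
    x % m                                  ≡⟨ m<n⇒m%n≡m (toℕ<n i) ⟩
    x                                      ∎)
    where
    open ≡-Reasoning
    x = toℕ i

  ⊕-⊖ : ∀ i j → (i ⊕ j) ⊖ j ≡ i
  ⊕-⊖ i j = mod-cancel i (toℕ j) (m ∸ toℕ j) (ℕ.m+[n∸m]≡n (ℕ.<⇒≤ (toℕ<n j)))

  ⊖-⊕ : ∀ d j → (d ⊖ j) ⊕ j ≡ d
  ⊖-⊕ d j = mod-cancel d (m ∸ toℕ j) (toℕ j) (ℕ.m∸n+n≡m (ℕ.<⇒≤ (toℕ<n j)))

  ⊕-comm : ∀ i j → i ⊕ j ≡ j ⊕ i
  ⊕-comm i j = cong (_mod m) (ℕ.+-comm (toℕ i) (toℕ j))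

  translation : Fin m → Permutation′ m
  translation j = mk↔ₛ′ (_⊕ j) (_⊖ j) (λ d → ⊖-⊕ d j) (λ i → ⊕-⊖ i j)

-- The array and its sums

module Construction {t k : ℕ} .{{_ : NonZero (t + k)}} (L : Layers (t + k) t ((t + k) * t)) where
  private
    -- In this form the test d < t for a filled layer is `splitAt t`.
    m = t + k
  open Layers L
  open Latin m

  slot : Fin 2 → Fin m → Fin t ⊎ Fin k → Maybe ℤ
  slot h j = [ (λ d → just (entry h d j)) , const nothing ]′

  cell : Fin m → Fin 2 × Fin m → Maybe ℤ
  cell i (h , j) = slot h j (splitAt t (i ⊕ j))

  array : PartialArray m (2 * m)
  array i J = cell i (remQuot m J)

  module _ {c ℓ} (M : CommutativeMonoid c ℓ) where
    open CommutativeMonoid M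
      renaming (trans to ≈-trans; sym to ≈-sym)
      using (Carrier; _≈_; ε; reflexive)
    open CommutativeMonoidSum M using (sum; sum-permute; sum-cong-≋)

    -- For fixed `j`, the map `_⊕ j` permutes the layers. The weight `φ` is later either `occupied`
    -- or `value`.
    sum-column : ∀ (φ : Maybe ℤ → Carrier) → φ nothing ≈ ε → ∀ h j →
                 sum (λ i → φ (cell i (h , j))) ≈ sum (λ d → φ (just (entry h d j)))
    sum-column φ φ≈ε h j = ≈-trans
      (≈-sym (sum-permute (λ d → φ (slot h j (splitAt t d))) (translation j)))
      (sum-supported M t (φ ∘ slot h j) (λ _ → φ≈ε))

    -- For fixed `i`, substitute j = d ⊖ i: the row meets layer d in exactly that column of each
    -- half.
    sum-row : ∀ (φ : Maybe ℤ → Carrier) → φ nothing ≈ ε → ∀ h i →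
              sum (λ j → φ (cell i (h , j))) ≈
              sum (λ d → φ (just (entry h d ((d ↑ˡ k) ⊖ i))))
    sum-row φ φ≈ε h i = ≈-trans
      (sum-cong-≋ (λ j → reflexive (cong φ (reindex j))))
      (≈-trans (≈-sym (sum-permute (λ d → φ (slot h (d ⊖ i) (splitAt t d))) (translation i)))
      (≈-trans (sum-cong-≋ (λ d → reflexive (cong φ (rejoin d (splitAt t d) refl))))
      (sum-supported M t (φ ∘ slot′) (λ _ → φ≈ε))))
      where
      reindex : ∀ j → cell i (h , j) ≡ slot h ((j ⊕ i) ⊖ i) (splitAt t (j ⊕ i))
      reindex j = cong₂ (slot h) (sym (⊕-⊖ j i)) (cong (splitAt t) (⊕-comm i j))

      slot′ : Fin t ⊎ Fin k → Maybe ℤ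
      slot′ = [ (λ d → just (entry h d ((d ↑ˡ k) ⊖ i))) , const nothing ]′

      -- Here `d` also determines the column, so it must be rewritten there as `d′ ↑ˡ k`.
      rejoin : ∀ d x → splitAt t d ≡ x → slot h (d ⊖ i) x ≡ slot′ x
      rejoin d (inj₁ d′) eq = cong (λ y → just (entry h d′ (y ⊖ i))) (sym (splitAt⁻¹-↑ˡ eq))
      rejoin d (inj₂ _)  eq = refl

  module ℤSum = CommutativeMonoidSum ℤ.+-0-commutativeMonoid

  occupied : Maybe ℤ → ℕ
  occupied c = if is-just c then 1 else 0

  value : Maybe ℤ → ℤ
  value = fromMaybe 0ℤ

  row-filled : ∀ i → filled (array i) ≡ 2 * t
  row-filled i = begin
    filled (array i)
      ≡⟨ sum-halves ℕ.+-0-commutativeMonoid m (occupied ∘ cell i) ⟩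
    sumℕ (λ j → occupied (cell i (0F , j))) + sumℕ (λ j → occupied (cell i (1F , j)))
      ≡⟨ cong₂ _+_ (half 0F) (half 1F) ⟩
    t + t
      ≡⟨ cong (t +_) (sym (ℕ.+-identityʳ t)) ⟩
    2 * t
      ∎
    where
    open ≡-Reasoning
    half : ∀ h → sumℕ (λ j → occupied (cell i (h , j))) ≡ t
    half h = trans (sum-row ℕ.+-0-commutativeMonoid occupied refl h i) (sum-ones t)

  col-filled : ∀ J → filled (λ i → array i J) ≡ t
  col-filled J = let h , j = remQuot m J in
    trans (sum-column ℕ.+-0-commutativeMonoid occupied refl h j) (sum-ones t)

  row-sum : ∀ i → total (array i) ≡ 0ℤ
  row-sum i = begin
    total (array i)
      ≡⟨ sum-halves ℤ.+-0-commutativeMonoid m (value ∘ cell i) ⟩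
    sumℤ (λ j → value (cell i (0F , j))) +ℤ sumℤ (λ j → value (cell i (1F , j)))
      ≡⟨ cong₂ _+ℤ_ (sum-row ℤ.+-0-commutativeMonoid value refl 0F i)
                    (sum-row ℤ.+-0-commutativeMonoid value refl 1F i) ⟩
    sumℤ (λ d → entry 0F d ((d ↑ˡ k) ⊖ i)) +ℤ sumℤ (λ d → entry 1F d ((d ↑ˡ k) ⊖ i))
      ≡⟨ sym (ℤSum.∑-distrib-+ (λ d → entry 0F d ((d ↑ˡ k) ⊖ i)) (λ d → entry 1F d ((d ↑ˡ k) ⊖ i))) ⟩
    sumℤ (λ d → entry 0F d ((d ↑ˡ k) ⊖ i) +ℤ entry 1F d ((d ↑ˡ k) ⊖ i))
      -- Both halves meet layer d in the same column, so `pair` applies even though that column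
      -- varies with d.
      ≡⟨ ℤSum.sum-cong-≗ (λ d → pair d ((d ↑ˡ k) ⊖ i)) ⟩
    sumℤ pairSum
      ≡⟨ pairSum-zero ⟩
    0ℤ
      ∎
    where open ≡-Reasoning

  col-sum : ∀ J → total (λ i → array i J) ≡ 0ℤ
  col-sum J = let h , j = remQuot m J in
    trans (sum-column ℤ.+-0-commutativeMonoid value refl h j) (column-zero h j)

  -- Each admissible integer occurs exactly once

  cell-just : ∀ {i h j z} → cell i (h , j) ≡ just z → ∃ λ d → d ↑ˡ k ≡ i ⊕ j × entry h d j ≡ z
  cell-just {i} {h} {j} eq with splitAt t (i ⊕ j) in split
  ... | inj₁ d = d , splitAt⁻¹-↑ˡ split , just-injective eq

  -- The count of entries is even, so the admissible set is ±1, ..., ±mt without zero, as coded by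
  -- `Sign × Fin (m * t)`.
  size : m * (2 * t) ≡ m * t * 2
  size = trans (cong (m *_) (ℕ.*-comm 2 t)) (sym (ℕ.*-assoc m t 2))

  size-even : m * (2 * t) % 2 ≡ 0
  size-even = trans (cong (_% 2) size) (m*n%n≡0 (m * t) 2)

  size-half : m * (2 * t) / 2 ≡ m * t
  size-half = trans (cong (_/ 2) size) (m*n/n≡m (m * t) 2)

  entries : ∀ i J z → array i J ≡ just z → z ∈X (m * (2 * t))
  entries i J z eq with cell-just {i} eq
  ... | d , _ , refl = let h , j = remQuot m J; s , x = Inverse.to position (h , d , j) in
    even size-even
      (subst (1 ≤_) (sym (ℤ.abs-◃ s (suc (toℕ x)))) (s≤s z≤n))
      (subst (_≤ m * (2 * t) / 2) (sym (ℤ.abs-◃ s (suc (toℕ x))))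
        (subst (suc (toℕ x) ≤_) (sym size-half) (toℕ<n x)))

  ∈X⇒code : ∀ z → z ∈X (m * (2 * t)) → ∃ λ ((s , x) : Sign × Fin (m * t)) → s ◃ suc (toℕ x) ≡ z
  ∈X⇒code z (odd odd-size _) = contradiction (trans (sym size-even) odd-size) λ ()
  ∈X⇒code z (even _ 1≤∣z∣ ∣z∣≤) with ∣ z ∣ in abs
  ∈X⇒code z (even _ (s≤s _) ∣z∣≤) | suc x =
    (sign z , fromℕ< x<) , trans (cong (λ y → sign z ◃ suc y) (toℕ-fromℕ< x<))
                                 (trans (cong (sign z ◃_) (sym abs)) (ℤ.◃-inverse z))
    where
    x< : x < m * t
    x< = subst (suc x ≤_) size-half ∣z∣≤

  -- The absolute value is a successor, hence nonzero, so the sign can be recovered.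
  code-injective : ∀ {p q : Sign × Fin (m * t)} →
                   proj₁ p ◃ suc (toℕ (proj₂ p)) ≡ proj₁ q ◃ suc (toℕ (proj₂ q)) → p ≡ q
  code-injective {s , x} {s′ , x′} eq = cong₂ _,_
    (trans (sym (ℤ.sign-◃ s (suc (toℕ x)))) (trans (cong sign eq) (ℤ.sign-◃ s′ (suc (toℕ x′)))))
    (toℕ-injective (ℕ.suc-injective (ℤ.abs-cong {s = s} {t = s′} eq)))

  position-injective : ∀ {p q} → Inverse.to position p ≡ Inverse.to position q → p ≡ q
  position-injective {p} {q} eq = trans (sym (Inverse.strictlyInverseʳ position p))
    (trans (cong (Inverse.from position) eq) (Inverse.strictlyInverseʳ position q))

  -- The row solves i ⊕ j = d for i.
  locate : Fin 2 × Fin t × Fin m → Fin m × Fin (2 * m)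
  locate (h , d , j) = (d ↑ˡ k) ⊖ j , combine h j

  once : ∀ z → z ∈X (m * (2 * t)) →
         ∃! _≡_ λ ((i , J) : Fin m × Fin (2 * m)) → array i J ≡ just z
  once z z∈X with ∈X⇒code z z∈X
  -- The code of `z` is replaced by the position of its preimage, so that `z` becomes `entry h d j`.
  ... | p , refl with Inverse.from position p | Inverse.strictlyInverseˡ position p
  ... | h , d , j | refl = locate (h , d , j) , present , unique
    where
    present : array ((d ↑ˡ k) ⊖ j) (combine h j) ≡ just (entry h d j)
    present = begin
      cell ((d ↑ˡ k) ⊖ j) (remQuot m (combine h j)) ≡⟨ cong (cell ((d ↑ˡ k) ⊖ j)) (remQuot-combine h j) ⟩
      slot h j (splitAt t (((d ↑ˡ k) ⊖ j) ⊕ j))     ≡⟨ cong (slot h j ∘ splitAt t) (⊖-⊕ (d ↑ˡ k) j) ⟩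
      slot h j (splitAt t (d ↑ˡ k))                 ≡⟨ cong (slot h j) (splitAt-↑ˡ t d k) ⟩
      just (entry h d j)                            ∎
      where open ≡-Reasoning

    unique : ∀ {q} → array (proj₁ q) (proj₂ q) ≡ just (entry h d j) →
             locate (h , d , j) ≡ q
    unique {i′ , J′} eq with cell-just {i′} eq
    ... | d′ , d′≡ , entry≡ = let h′ , j′ = remQuot m J′ in trans
      -- Equal entries have equal codes and hence equal triples; `locate` then returns the cell from
      -- which the second triple was read.
      (cong locate (position-injective (code-injective (sym entry≡))))
      (cong₂ _,_ (trans (cong (_⊖ j′) d′≡) (⊕-⊖ i′ j′)) (combine-remQuot {2} m J′))

  isSMA : IsSMA m (2 * m) (2 * t) t array
  isSMA = record
    { entries    = entries
    ; row-filled = row-filled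
    ; col-filled = col-filled
    ; once       = once
    ; row-sum    = row-sum
    ; col-sum    = col-sum
    }

theorem11 : ∀ (m t : ℕ) → m ≥ t → t ≥ 3 →
    ((m * t) % 4 ≡ 0) ⊎ ((m * t) % 4 ≡ 3) →
    ∃ λ (A : PartialArray m (2 * m)) → IsSMA m (2 * m) (2 * t) t A
-- Exposing the successors of `t` makes `t + k` visibly nonzero and lets `λ ()` refute that `t` is
-- 1.
theorem11 m t@(suc (suc (suc _))) m≥t (s≤s (s≤s (s≤s _))) _ with ℕ.m≤n⇒∃[o]m+o≡n m≥t
... | k , refl = Construction.array L , Construction.isSMA L
  where
  L : Layers (t + k) t ((t + k) * t)
  L = layersOfSize (t + k) t λ ()
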